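{- For a fixed $\tau=\tau_1\ldots\tau_k\in\mathcal{S}_k$ and $n\ge k$, the number $\mathrm{inv}_n(\tau)$ of involutions in $\mathcal{S}_n$ which contain $\tau$ as a subsequence equals $$\sum_{j\in\mathcal{J}(\tau)}\binom{n-k}{k-j}t_{n-2k+j}.$$
   Context: $t_m$ denotes the number of involutions in $\mathcal{S}_m$ ($t_0=1$); terms with $k-j>n-k$ are $0$. A permutation $\pi=\pi_1\ldots\pi_n$ contains $\tau$ as a subsequence if there are indices $i_1<\cdots<i_k$ with $\pi_{i_r}=\tau_r$ for all $r$. The pattern of a word of $j$ distinct letters is its order-preserving relabeling by $\{1,\ldots,j\}$; the length-$j$ initial pattern of $\tau$ is the pattern of $\tau_1\ldots\tau_j$. The $j$-set $\mathcal{J}(\tau)$ of $\tau\in\mathcal{S}_k$ is the set consisting of $0$ together with all $j\in\{1,\ldots,k\}$ such that the length-$j$ initial pattern of $\tau$ is an involution in $\mathcal{S}_j$. -}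

module Defs where

open import Algebra.Definitions using (Involutive)
open import Data.Fin.Base as Fin using (Fin; zero; suc; toℕ; inject≤)
open import Data.Fin.Permutation
open import Data.Fin.Properties as Fin using (all?; any?)
open import Data.List.Base
  using (List; []; _∷_; [_]; length; filter; cartesianProductWith; allFin; upTo)
open import Data.List.Membership.Propositional.Properties using (∈-allFin)
open import Data.List.Relation.Unary.All using ([])
open import Data.List.Relation.Unary.AllPairs using ([]; _∷_)
open import Data.List.Relation.Unary.Any as Any using (Any; here)
open import Data.List.Relation.Unary.Any.Properties using (cartesianProductWith⁺)
import Data.List.Relation.Unary.Unique.Propositional.Properties as Unique
import Data.List.Relation.Unary.Unique.Setoid as UniqueSetoid
import Data.List.Relation.Unary.Unique.Setoid.Properties as UniqueSetoidₚ
open import Data.Nat.Base using (ℕ; zero; suc; _≤_)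
open import Data.Nat.Properties as ℕ using (_≤?_)
open import Data.Product.Base using (Σ-syntax; ∃-syntax; _×_; _,_; proj₁; proj₂)
open import Data.Sum.Base using (_⊎_)
open import Function.Base using (_∘_)
open import Function.Bundles using (_⇔_; mk⇔; Equivalence)
open import Level using (0ℓ)
open import Relation.Binary.Bundles using (Setoid)
open import Relation.Binary.Core using (_Preserves_⟶_)
open import Relation.Binary.PropositionalEquality
  using (_≡_; refl; sym; trans; cong; subst₂; setoid)
open import Relation.Nullary using (Dec; yes; no)
open import Relation.Nullary.Decidable using (map′; _×-dec_; _⊎-dec_; _→-dec_)

private
  variable
    j k n : ℕ

-- Letters are 0-based: τ = τ₁…τₖ is the permutation sending the
-- position r - 1 to τᵣ - 1.

≈-setoid : ℕ → Setoid 0ℓ 0ℓ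
≈-setoid n = record
  { Carrier       = Permutation′ n
  ; _≈_           = _≈_
  ; isEquivalence = record
    { refl  = λ _ → refl
    ; sym   = λ p i → sym (p i)
    ; trans = λ p q i → trans (p i) (q i)
    }
  }

-- Permutations carry their inverse and coherence proofs, so they are only
-- compared pointwise.  The two lemmas after this definition show that every
-- element of 𝒮ₙ occurs in the list exactly once up to _≈_.

permutations : ∀ n → List (Permutation′ n)
permutations zero    = [ id ]
permutations (suc n) =
  cartesianProductWith (insert zero) (allFin (suc n)) (permutations n)

permutations-complete : ∀ n (π : Permutation′ n) → Any (π ≈_) (permutations n)
permutations-complete zero    π = here λ ()
permutations-complete (suc n) π =
  cartesianProductWith⁺ (insert zero) insert-≈
    (∈-allFin (π ⟨$⟩ʳ zero)) (permutations-complete n (remove zero π))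
  where
  insert-≈ : ∀ {x ρ} → π ⟨$⟩ʳ zero ≡ x → remove zero π ≈ ρ → π ≈ insert zero x ρ
  insert-≈ refl p zero    = refl
  insert-≈ refl p (suc i) =
    trans (punchIn-permute π zero i) (cong (Fin.punchIn (π ⟨$⟩ʳ zero)) (p i))

permutations-unique : ∀ n → UniqueSetoid.Unique (≈-setoid n) (permutations n)
permutations-unique zero    = [] ∷ []
permutations-unique (suc n) =
  UniqueSetoidₚ.cartesianProductWith⁺
    (setoid (Fin (suc n))) (≈-setoid n) (≈-setoid (suc n))
    (insert zero) insert-injective (Unique.allFin⁺ (suc n)) (permutations-unique n)
  where
  insert-injective : ∀ {x y} {ρ σ : Permutation′ n} →
                     insert zero x ρ ≈ insert zero y σ → x ≡ y × ρ ≈ σ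
  insert-injective {x} p with refl ← p zero =
    refl , λ i → Fin.punchIn-injective x _ _ (p (suc i))

IsInvolution : Permutation′ n → Set
IsInvolution π = Involutive _≡_ (π ⟨$⟩ʳ_)

isInvolution? : (π : Permutation′ n) → Dec (IsInvolution π)
isInvolution? π = all? λ i → π ⟨$⟩ʳ (π ⟨$⟩ʳ i) Fin.≟ i

t : ℕ → ℕ
t m = length (filter isInvolution? (permutations m))

-- The letters themselves have to agree, not just their relative order.

Contains : Permutation′ n → Permutation′ k → Set
Contains {n} {k} π τ =
  Σ[ ι ∈ (Fin k → Fin n) ]
    ι Preserves Fin._<_ ⟶ Fin._<_ ×
    (∀ r → toℕ (π ⟨$⟩ʳ ι r) ≡ toℕ (τ ⟨$⟩ʳ r))

contains? : (π : Permutation′ n) (τ : Permutation′ k) → Dec (Contains π τ)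
contains? π τ with all? (λ r → any? λ i → toℕ (π ⟨$⟩ʳ i) ℕ.≟ toℕ (τ ⟨$⟩ʳ r))
... | no ¬found = no λ (ι , _ , eq) → ¬found λ r → ι r , eq r
... | yes found = map′
  (λ mono → proj₁ ∘ found , (λ {r} {s} → mono r s) , proj₂ ∘ found)
  (λ (ι , mono , eq) r s r<s →
    subst₂ Fin._<_ (position-unique ι eq r) (position-unique ι eq s) (mono r<s))
  (all? λ r → all? λ s →
    (r Fin.<? s) →-dec (proj₁ (found r) Fin.<? proj₁ (found s)))
  where
  position-unique : ∀ ι → (∀ r → toℕ (π ⟨$⟩ʳ ι r) ≡ toℕ (τ ⟨$⟩ʳ r)) →
                    ∀ r → ι r ≡ proj₁ (found r)
  position-unique ι eq r = trans (sym (inverseˡ π)) (trans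
    (cong (π ⟨$⟩ˡ_) (Fin.toℕ-injective (trans (eq r) (sym (proj₂ (found r))))))
    (inverseˡ π))

inv : ∀ n → Permutation′ k → ℕ
inv n τ =
  length (filter (λ π → isInvolution? π ×-dec contains? π τ) (permutations n))

-- For w with distinct letters there is exactly one such σ up to _≈_.

IsPatternOf : Permutation′ j → (Fin j → Fin k) → Set
IsPatternOf σ w = ∀ a b → w a Fin.< w b ⇔ σ ⟨$⟩ʳ a Fin.< σ ⟨$⟩ʳ b

isPatternOf? : (σ : Permutation′ j) (w : Fin j → Fin k) → Dec (IsPatternOf σ w)
isPatternOf? σ w = all? λ a → all? λ b →
  let p? = w a Fin.<? w b
      q? = σ ⟨$⟩ʳ a Fin.<? σ ⟨$⟩ʳ b
  in map′ (λ (f , g) → mk⇔ f g) (λ e → Equivalence.to e , Equivalence.from e)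
       ((p? →-dec q?) ×-dec (q? →-dec p?))

initialWord : Permutation′ k → j ≤ k → Fin j → Fin k
initialWord τ j≤k i = τ ⟨$⟩ʳ inject≤ i j≤k

InitialPatternIsInvolution : Permutation′ k → j ≤ k → Set
InitialPatternIsInvolution {j = j} τ j≤k =
  ∃[ σ ] IsPatternOf {j} σ (initialWord τ j≤k) × IsInvolution σ

initialPatternIsInvolution? : (τ : Permutation′ k) (j≤k : j ≤ k) →
                              Dec (InitialPatternIsInvolution τ j≤k)
initialPatternIsInvolution? {j = j} τ j≤k = map′ Any.satisfied
  (λ (σ , pat , invo) →
    Any.map (λ {ρ} σ≈ρ → resp-pat {σ} {ρ} σ≈ρ pat , resp-inv {σ} {ρ} σ≈ρ invo)
      (permutations-complete j σ))
  (Any.any? (λ σ → isPatternOf? σ w ×-dec isInvolution? σ) (permutations j))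
  where
  w = initialWord τ j≤k

  resp-pat : ∀ {σ ρ} → σ ≈ ρ → IsPatternOf σ w → IsPatternOf ρ w
  resp-pat σ≈ρ pat a b rewrite sym (σ≈ρ a) | sym (σ≈ρ b) = pat a b

  resp-inv : ∀ {σ ρ : Permutation′ j} → σ ≈ ρ → IsInvolution σ → IsInvolution ρ
  resp-inv {σ} {ρ} σ≈ρ invo i =
    trans (cong (ρ ⟨$⟩ʳ_) (sym (σ≈ρ i))) (trans (sym (σ≈ρ (σ ⟨$⟩ʳ i))) (invo i))

InJSet : Permutation′ k → ℕ → Set
InJSet {k} τ j =
  j ≡ 0 ⊎ (1 ≤ j × Σ[ j≤k ∈ j ≤ k ] InitialPatternIsInvolution τ j≤k)

inJSet? : (τ : Permutation′ k) (j : ℕ) → Dec (InJSet τ j)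
inJSet? {k} τ j = (j ℕ.≟ 0) ⊎-dec ((1 ≤? j) ×-dec pattern?)
  where
  pattern? : Dec (Σ[ j≤k ∈ j ≤ k ] InitialPatternIsInvolution τ j≤k)
  pattern? with j ≤? k
  ... | no j≰k  = no (j≰k ∘ proj₁)
  ... | yes j≤k = map′ (j≤k ,_) (λ (_ , p) → p) (initialPatternIsInvolution? τ j≤k)

jSet : Permutation′ k → List ℕ
jSet {k} τ = filter (inJSet? τ) (upTo (suc k))

{-# OPTIONS --safe #-}

-- In an involution π the letter x stands at position π x, so π contains τ iff π τ₁ < … < π τₖ.
-- The letters that π keeps inside {1,…,k} then come first, say τ₁,…,τⱼ.  They form a π-closed
-- set on which π is increasing along τ, so the pattern σ of τ₁…τⱼ is an involution and π sends
-- the a-th letter of τ to the σ(a)-th.  The remaining k − j letters go increasingly to positions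
-- above k, which leaves C(n−k, k−j) choices.  Each choice prescribes π on a closed set of 2k − j
-- points.  Composing with one fixed extension turns the involutions with these prescribed values
-- into those that fix the 2k − j points, and there are as many of these as involutions of the
-- other n − 2k + j points.

module Submission where

open import Data.Fin.Base as Fin
  using (Fin; zero; suc; toℕ; fromℕ<; splitAt; punchIn; punchOut; _↑ˡ_; _↑ʳ_)
open import Data.Fin.Permutation
  using (Permutation′; id; permutation; _⟨$⟩ʳ_; _⟨$⟩ˡ_; _≈_; _∘ₚ_; insert; remove; insert-punchIn;
         punchIn-permute; inverseˡ; inverseʳ)
open import Data.Fin.Properties as Fin
  using (any?; join-splitAt; punchIn-injective; punchIn-punchOut; punchOut-injective;
         splitAt-↑ˡ; splitAt-↑ʳ; toℕ-fromℕ<; toℕ-inject≤; toℕ-injective; toℕ-↑ˡ; toℕ-↑ʳ;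
         toℕ<n; ↑ˡ-injective; ↑ʳ-injective)
open import Data.List.Base using (List; []; _∷_; [_]; _++_; filter; length; lookup; map; upTo)
import Data.List.Membership.Propositional.Properties as Membership
import Data.List.Membership.Setoid as SetoidMembership
import Data.List.Membership.Setoid.Properties as Membershipₛ
open import Data.List.Properties using (length-map; length-++)
open import Data.List.Relation.Unary.All as All using (All; []; _∷_)
import Data.List.Relation.Unary.All.Properties as All
open import Data.List.Relation.Unary.AllPairs using ([]; _∷_)
open import Data.List.Relation.Unary.Any as Any using (Any; here; there)
import Data.List.Relation.Unary.Any.Properties as Any
import Data.List.Relation.Unary.Unique.Propositional.Properties as Unique
open import Data.List.Relation.Unary.Unique.Setoid using (Unique)
import Data.List.Relation.Unary.Unique.Setoid.Properties as Uniqueₛ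
open import Data.Nat.Base
  using (ℕ; zero; suc; _+_; _*_; _∸_; _≤_; _<_; z≤n; s≤s; z<s; s<s; s<s⁻¹)
open import Data.Nat.Combinatorics using (_C_; nCk+nC[k+1]≡[n+1]C[k+1])
open import Data.Nat.ListAction using (sum)
import Data.Nat.Properties as ℕ
open import Data.Product.Base using (∃-syntax; _×_; _,_; proj₁; proj₂)
open import Data.Sum.Base using (_⊎_; inj₁; inj₂; [_,_]′)
open import Function.Base using (_∘_)
open import Function.Bundles using (mk⇔; Equivalence)
open import Function.Definitions using (Injective)
open import Level using (0ℓ)
open import Relation.Binary.Bundles using (Setoid)
open import Relation.Binary.Core using (_Preserves_⟶_)
open import Relation.Binary.Definitions using (_Respects_; tri<; tri≈; tri>)
open import Relation.Binary.PropositionalEquality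
  using (_≡_; _≢_; refl; sym; trans; cong; cong₂; subst; subst₂; setoid; _→-setoid_;
         module ≡-Reasoning)
open import Relation.Nullary using (¬_; contradiction; yes; no; _×-dec_)
open import Relation.Unary using (Pred; Decidable)
open import Defs

open Setoid using (Carrier)

private
  variable
    j k l m n r : ℕ

-- Counting up to a setoid equality

-- Permutations and functions are compared pointwise, so a count is witnessed by a list that is
-- repetition-free up to the setoid equality. With the size as an index, arithmetic identities can
-- be transported by `subst`.
record Enumeration (S : Setoid 0ℓ 0ℓ) (P : Pred (Carrier S) 0ℓ) (n : ℕ) : Set where
  constructor enumeration
  open SetoidMembership S using (_∈_)
  field
    elements : List (Carrier S)
    sound    : All P elements
    complete : ∀ {x} → P x → x ∈ elements
    unique   : Unique S elements
    size     : length elements ≡ n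

module _ {S : Setoid 0ℓ 0ℓ} where
  private
    module S = Setoid S
  open SetoidMembership S using (_∈_)

  lookup-injective : ∀ {xs} → Unique S xs → ∀ i j → lookup xs i S.≈ lookup xs j → i ≡ j
  lookup-injective (_ ∷ _)    zero    zero    _ = refl
  lookup-injective (x∉ ∷ _)   zero    (suc j) p =
    contradiction (Membershipₛ.∈-resp-≈ S (S.sym p) (Membershipₛ.∈-lookup S _ j))
      (Membershipₛ.All[≉]⇒∉ S x∉)
  lookup-injective (x∉ ∷ _)   (suc i) zero    p =
    contradiction (Membershipₛ.∈-resp-≈ S p (Membershipₛ.∈-lookup S _ i))
      (Membershipₛ.All[≉]⇒∉ S x∉)
  lookup-injective (_ ∷ xs!)  (suc i) (suc j) p = cong suc (lookup-injective xs! i j p)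

  -- Pigeonhole: sending each position of `xs` to the position of a matching entry of `ys` is
  -- injective.
  unique-⊆⇒length-≤ : ∀ {xs ys} → Unique S xs → All (_∈ ys) xs → length xs ≤ length ys
  unique-⊆⇒length-≤ {xs} xs! xs⊆ys = Fin.injective⇒≤ λ {i} {j} p →
    lookup-injective xs! i j
      (Membershipₛ.index-injective S
        (All.lookup xs⊆ys (Membership.∈-lookup i)) (All.lookup xs⊆ys (Membership.∈-lookup j)) p)

  -- Each list lies inside the other. This turns two counts of one predicate into an equation
  -- between numbers.
  size-unique : ∀ {P m n} → Enumeration S P m → Enumeration S P n → m ≡ n
  size-unique X Y = trans (sym (size X)) (trans
    (ℕ.≤-antisym
      (unique-⊆⇒length-≤ (unique X) (All.map (complete Y) (sound X)))
      (unique-⊆⇒length-≤ (unique Y) (All.map (complete X) (sound Y))))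
    (size Y))
    where open Enumeration

  mapPred : ∀ {P Q n} → (∀ {x} → P x → Q x) → (∀ {x} → Q x → P x) →
            Enumeration S P n → Enumeration S Q n
  mapPred f g (enumeration xs s c u eq) = enumeration xs (All.map f s) (c ∘ g) u eq

  none : ∀ {P} → (∀ {x} → ¬ P x) → Enumeration S P 0
  none ¬p = enumeration [] [] (λ p → contradiction p ¬p) [] refl

  union : ∀ {P Q m n} → (∀ {x y} → P x → Q y → ¬ x S.≈ y) →
          Enumeration S P m → Enumeration S Q n → Enumeration S (λ x → P x ⊎ Q x) (m + n)
  union disjoint (enumeration xs s c u eq) (enumeration ys s′ c′ u′ eq′) = enumeration
    (xs ++ ys)
    (All.++⁺ (All.map inj₁ s) (All.map inj₂ s′))
    [ Membershipₛ.∈-++⁺ˡ S ∘ c , Membershipₛ.∈-++⁺ʳ S xs ∘ c′ ]′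
    (Uniqueₛ.++⁺ S u u′ λ (v∈xs , v∈ys) →
      let (px , v≈x) = All.lookupAny s v∈xs
          (qy , v≈y) = All.lookupAny s′ v∈ys
      in disjoint px qy (S.trans (S.sym v≈x) v≈y))
    (trans (length-++ xs) (cong₂ _+_ eq eq′))

  -- Blocks that share an element have equal indices, so distinct entries of `ys` give disjoint
  -- blocks and the sizes add. The index is later a choice of positions `g`, and then a level `j`.
  ⋃ : ∀ {T : Setoid 0ℓ 0ℓ} {Q : Carrier T → Pred (Carrier S) 0ℓ} {N : Carrier T → ℕ} {ys} →
      Unique T ys →
      (∀ {a b x y} → Q a x → Q b y → x S.≈ y → Setoid._≈_ T a b) →
      All (λ a → Enumeration S (Q a) (N a)) ys →
      Enumeration S (λ x → Any (λ a → Q a x) ys) (sum (map N ys))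
  ⋃ []         disjoint []       = none λ ()
  ⋃ {T} {Q} (a∉ ∷ ys!) disjoint (X ∷ Xs) = mapPred
    [ here , there ]′ Any.toSum
    (union (λ p q x≈y → Membershipₛ.All[≉]⇒∉ T a∉ (Any.map (λ r → disjoint p r x≈y) q))
      X (⋃ {T} {Q} ys! disjoint Xs))

module _ {S T : Setoid 0ℓ 0ℓ} where
  private
    module S = Setoid S
    module T = Setoid T

  image : ∀ {P Q n} (f : S.Carrier → T.Carrier) →
          f Preserves S._≈_ ⟶ T._≈_ →
          (∀ {x y} → f x T.≈ f y → x S.≈ y) →
          (∀ {x} → P x → Q (f x)) →
          (∀ {y} → Q y → ∃[ x ] P x × y T.≈ f x) →
          Enumeration S P n → Enumeration T Q n
  image f pres inj P⇒Q onto (enumeration xs s c u eq) = enumeration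
    (map f xs)
    (All.map⁺ (All.map P⇒Q s))
    (λ q → let (x , p , y≈fx) = onto q in
      Membershipₛ.∈-resp-≈ T (T.sym y≈fx) (Membershipₛ.∈-map⁺ S T pres (c p)))
    (Uniqueₛ.map⁺ S T inj u)
    (trans (length-map f xs) eq)

-- This links enumerations to the filter lengths by which `t` and `inv` are defined.
enumerate-permutations : ∀ {P : Pred (Permutation′ n) 0ℓ} (P? : Decidable P) → P Respects _≈_ →
  Enumeration (≈-setoid n) P (length (filter P? (permutations n)))
enumerate-permutations {n} P? resp = enumeration
  (filter P? (permutations n))
  (All.all-filter P? (permutations n))
  (λ {π} p → Membershipₛ.∈-filter⁺ (≈-setoid n) P? resp (permutations-complete n π) p)
  (Uniqueₛ.filter⁺ (≈-setoid n) P? (permutations-unique n))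
  refl

isInvolution-resp : IsInvolution {n} Respects _≈_
isInvolution-resp {x = π} {ρ} π≈ρ invo i =
  trans (sym (π≈ρ (ρ ⟨$⟩ʳ i))) (trans (cong (π ⟨$⟩ʳ_) (sym (π≈ρ i))) (invo i))

permutation-injective : (π : Permutation′ n) → Injective _≡_ _≡_ (π ⟨$⟩ʳ_)
permutation-injective π eq = trans (sym (inverseˡ π)) (trans (cong (π ⟨$⟩ˡ_) eq) (inverseˡ π))

punchIn-elim : ∀ {P : Fin (suc n) → Set} i → P i → (∀ k → P (punchIn i k)) → ∀ k → P k
punchIn-elim {P = P} i pi pk k with i Fin.≟ k
... | yes refl = pi
... | no  i≢k  = subst P (punchIn-punchOut i≢k) (pk (punchOut i≢k))

insert-self : ∀ i (π : Permutation′ n) → insert i i π ⟨$⟩ʳ i ≡ i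
insert-self i π with i Fin.≟ i
... | yes _   = refl
... | no  i≢i = contradiction refl i≢i

-- Involutions with prescribed values on a closed set

FixedInvolution : (Fin r → Fin n) → Permutation′ n → Set
FixedInvolution d π = IsInvolution π × ∀ i → π ⟨$⟩ʳ d i ≡ d i

-- Induction on `r`: inserting the fixed point `d zero` is a bijection from the involutions on one
-- point fewer, where `punchOut` relabels the other fixed points. Once no point is prescribed, `t`
-- counts what is left.
enumerate-fixed : ∀ (d : Fin r → Fin n) → Injective _≡_ _≡_ d →
                  Enumeration (≈-setoid n) (FixedInvolution d) (t (n ∸ r))
enumerate-fixed {zero} d d-inj =
  mapPred (λ invo → invo , λ ()) proj₁
    (enumerate-permutations isInvolution? λ {π} {ρ} → isInvolution-resp {x = π} {ρ})
enumerate-fixed {suc r} {zero}  d d-inj with () ← d zero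
enumerate-fixed {suc r} {suc n} d d-inj = image (insert d₀ d₀)
  (λ {ρ} {σ} ρ≈σ → punchIn-elim d₀ (trans (insert-self d₀ ρ) (sym (insert-self d₀ σ)))
    λ k → trans (insert-punchIn d₀ d₀ ρ k) (trans (cong (punchIn d₀) (ρ≈σ k))
      (sym (insert-punchIn d₀ d₀ σ k))))
  (λ {ρ} {σ} eq k → punchIn-injective d₀ _ _ (trans (sym (insert-punchIn d₀ d₀ ρ k))
    (trans (eq (punchIn d₀ k)) (insert-punchIn d₀ d₀ σ k))))
  (λ {ρ} → insert-fixed ρ)
  (λ {π} → remove-fixed π)
  (enumerate-fixed d′ λ eq → Fin.suc-injective (d-inj (punchOut-injective (d₀≢ _) (d₀≢ _) eq)))
  where
  d₀ = d zero

  d₀≢ : ∀ i → d₀ ≢ d (suc i)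
  d₀≢ i eq with () ← d-inj eq

  d′ : Fin r → Fin n
  d′ i = punchOut (d₀≢ i)

  insert-fixed : ∀ ρ → FixedInvolution d′ ρ → FixedInvolution d (insert d₀ d₀ ρ)
  insert-fixed ρ (invo , fix) =
    punchIn-elim d₀
      (trans (cong (insert d₀ d₀ ρ ⟨$⟩ʳ_) (insert-self d₀ ρ)) (insert-self d₀ ρ))
      (λ k → trans (cong (insert d₀ d₀ ρ ⟨$⟩ʳ_) (insert-punchIn d₀ d₀ ρ k))
        (trans (insert-punchIn d₀ d₀ ρ _) (cong (punchIn d₀) (invo k)))) ,
    λ where
      zero    → insert-self d₀ ρ
      (suc i) → subst (λ x → insert d₀ d₀ ρ ⟨$⟩ʳ x ≡ x) (punchIn-punchOut (d₀≢ i))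
        (trans (insert-punchIn d₀ d₀ ρ (d′ i)) (cong (punchIn d₀) (fix i)))

  remove-fixed : ∀ π → FixedInvolution d π →
                 ∃[ ρ ] FixedInvolution d′ ρ × π ≈ insert d₀ d₀ ρ
  remove-fixed π (invo , fix) = ρ , (ρ-invo , ρ-fix) ,
    punchIn-elim d₀ (trans (fix zero) (sym (insert-self d₀ ρ)))
      λ k → trans (step k) (sym (insert-punchIn d₀ d₀ ρ k))
    where
    ρ = remove d₀ π

    -- Since `π` fixes `d₀`, removal leaves the same gap in the domain and the codomain, so `ρ` is
    -- `π` relabelled.
    step : ∀ k → π ⟨$⟩ʳ punchIn d₀ k ≡ punchIn d₀ (ρ ⟨$⟩ʳ k)
    step k = trans (punchIn-permute π d₀ k) (cong (λ x → punchIn x (ρ ⟨$⟩ʳ k)) (fix zero))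

    ρ-invo : IsInvolution ρ
    ρ-invo k = punchIn-injective d₀ _ _ (trans (sym (step (ρ ⟨$⟩ʳ k)))
      (trans (cong (π ⟨$⟩ʳ_) (sym (step k))) (invo _)))

    ρ-fix : ∀ i → ρ ⟨$⟩ʳ d′ i ≡ d′ i
    ρ-fix i = punchIn-injective d₀ _ _ (trans (sym (step (d′ i)))
      (subst (λ x → π ⟨$⟩ʳ x ≡ x) (sym (punchIn-punchOut (d₀≢ i))) (fix (suc i))))

-- Composing with π₀ carries the involutions that agree with π₀ on d to those that fix d.
enumerate-extensions : ∀ (d : Fin r → Fin n) → Injective _≡_ _≡_ d →
  (π₀ : Permutation′ n) → IsInvolution π₀ →
  (∀ i → ∃[ i′ ] π₀ ⟨$⟩ʳ d i ≡ d i′) →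
  (∀ x → (∃[ i ] x ≡ d i) ⊎ π₀ ⟨$⟩ʳ x ≡ x) →
  Enumeration (≈-setoid n) (λ π → IsInvolution π × ∀ i → π ⟨$⟩ʳ d i ≡ π₀ ⟨$⟩ʳ d i) (t (n ∸ r))
enumerate-extensions {r} {n} d d-inj π₀ π₀-invo closed support = image (π₀ ∘ₚ_)
  (λ π≈ρ x → π≈ρ (π₀ ⟨$⟩ʳ x))
  (λ {π} {ρ} eq x → subst (λ y → π ⟨$⟩ʳ y ≡ ρ ⟨$⟩ʳ y) (π₀-invo x) (eq (π₀ ⟨$⟩ʳ x)))
  -- `π₀` moves `d i` to another point of `d`, which `π` fixes, so the composite agrees with `π₀` on
  -- `d`.
  (λ {π} (invo , fix) →
    let fix′ = λ i → trans (cong (π ⟨$⟩ʳ_) (proj₂ (closed i)))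
          (trans (fix (proj₁ (closed i))) (sym (proj₂ (closed i))))
    in composite-invo π invo (λ i → trans (fix′ i) (cong (π₀ ⟨$⟩ʳ_) (sym (fix i)))) , fix′)
  -- As `π₀` is its own inverse, composing with it once more gives the preimage.
  (λ {π} (invo , agree) → π₀ ∘ₚ π ,
    (composite-invo π invo (λ i → trans (cong (π ⟨$⟩ʳ_) (sym (agree i)))
        (trans (invo _) (trans (sym (π₀-invo _)) (cong (π₀ ⟨$⟩ʳ_) (sym (agree i)))))) ,
     λ i → trans (cong (π ⟨$⟩ʳ_) (sym (agree i))) (invo _)) ,
    λ x → cong (π ⟨$⟩ʳ_) (sym (π₀-invo x)))
  (enumerate-fixed d d-inj)
  where
  -- Commuting involutions compose to an involution. Commutation on `d` spreads to all points
  -- because `π₀` fixes the points outside `d`.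
  composite-invo : ∀ π → IsInvolution π →
                   (∀ i → π ⟨$⟩ʳ (π₀ ⟨$⟩ʳ d i) ≡ π₀ ⟨$⟩ʳ (π ⟨$⟩ʳ d i)) →
                   IsInvolution (π₀ ∘ₚ π)
  composite-invo π invo commute x =
    trans (cong (λ y → π ⟨$⟩ʳ (π₀ ⟨$⟩ʳ y)) (commutes x))
      (trans (cong (π ⟨$⟩ʳ_) (π₀-invo _)) (invo x))
    where
    commutes : ∀ x → π ⟨$⟩ʳ (π₀ ⟨$⟩ʳ x) ≡ π₀ ⟨$⟩ʳ (π ⟨$⟩ʳ x)
    commutes x with support x | support (π ⟨$⟩ʳ x)
    ... | inj₁ (i , refl) | _               = commute i
    ... | inj₂ x-fixed    | inj₂ πx-fixed   = trans (cong (π ⟨$⟩ʳ_) x-fixed) (sym πx-fixed)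
    -- Commutation at `π x` gives π(π₀(π x)) = π₀(π(π x)) = π₀ x = x = π(π x), and cancelling `π`
    -- shows that `π₀` fixes `π x` as well.
    ... | inj₂ x-fixed    | inj₁ (i , πx≡d) = trans (cong (π ⟨$⟩ʳ_) x-fixed)
      (permutation-injective π (trans (invo x) (sym
        (trans (cong (λ y → π ⟨$⟩ʳ (π₀ ⟨$⟩ʳ y)) πx≡d)
        (trans (commute i)
        (trans (cong (λ y → π₀ ⟨$⟩ʳ (π ⟨$⟩ʳ y)) (sym πx≡d))
        (trans (cong (π₀ ⟨$⟩ʳ_) (invo x)) x-fixed)))))))

-- Increasing functions

pointwise : ℕ → ℕ → Setoid 0ℓ 0ℓ
pointwise l m = Fin l →-setoid Fin m

Increasing : (Fin l → Fin m) → Set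
Increasing g = ∀ i j → i Fin.< j → g i Fin.< g j

lower : (h : Fin l → Fin (suc m)) → (∀ i → h i ≢ zero) → ∃[ h′ ] ∀ i → h i ≡ suc (h′ i)
lower h h≢0 = (λ i → punchOut (h≢0 i ∘ sym)) , λ i → sym (punchIn-punchOut (h≢0 i ∘ sym))

<⇒≢zero : ∀ {x y : Fin (suc m)} → x Fin.< y → y ≢ zero
<⇒≢zero () refl

-- Pascal's rule: if the first value is `zero`, the later values lowered by one are an increasing
-- function on `l` points; otherwise all `suc l` values can be lowered.
enumerate-increasing : ∀ l m → Enumeration (pointwise l m) Increasing (m C l)
enumerate-increasing zero    m       =
  enumeration [ (λ ()) ] ((λ ()) ∷ []) (λ _ → here λ ()) ([] ∷ []) refl
enumerate-increasing (suc l) zero    = none λ {g} _ → contradiction (g zero) λ ()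
enumerate-increasing (suc l) (suc m) =
  subst (Enumeration _ _) (nCk+nC[k+1]≡[n+1]C[k+1] m l)
  (mapPred {P = λ g → (g zero ≡ zero × Increasing g) ⊎ (g zero ≢ zero × Increasing g)}
    [ proj₂ , proj₂ ]′ split
    (union (λ (g₀≡0 , _) (h₀≢0 , _) g≈h → h₀≢0 (trans (sym (g≈h zero)) g₀≡0))
      (image extend
        (λ { g≈h zero → refl ; g≈h (suc i) → cong suc (g≈h i) })
        (λ eq i → Fin.suc-injective (eq (suc i)))
        (λ {g} incr → refl , extend-increasing {g} incr)
        (λ {g} (g₀≡0 , incr) → lower-tail g g₀≡0 incr)
        (enumerate-increasing l m))
      (image (suc ∘_)
        (λ g≈h i → cong suc (g≈h i))
        (λ eq i → Fin.suc-injective (eq i))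
        (λ incr → (λ ()) , λ i j i<j → s<s (incr i j i<j))
        (λ {g} (g₀≢0 , incr) → lower-all g g₀≢0 incr)
        (enumerate-increasing (suc l) m))))
  where
  extend : (Fin l → Fin m) → Fin (suc l) → Fin (suc m)
  extend g zero    = zero
  extend g (suc i) = suc (g i)

  extend-increasing : ∀ {g} → Increasing g → Increasing (extend g)
  extend-increasing incr zero    (suc j) _         = z<s
  extend-increasing incr (suc i) (suc j) (s<s i<j) = s<s (incr i j i<j)

  split : ∀ {g : Fin (suc l) → Fin (suc m)} → Increasing g →
          (g zero ≡ zero × Increasing g) ⊎ (g zero ≢ zero × Increasing g)
  split {g} incr with g zero Fin.≟ zero
  ... | yes g₀≡0 = inj₁ (g₀≡0 , incr)
  ... | no  g₀≢0 = inj₂ (g₀≢0 , incr)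

  lower-tail : ∀ g → g zero ≡ zero → Increasing g →
               ∃[ h ] Increasing h × (∀ i → g i ≡ extend h i)
  lower-tail g g₀≡0 incr =
    let (h , eq) = lower (g ∘ suc) (λ i → <⇒≢zero (incr zero (suc i) z<s))
    in h ,
       (λ i j i<j → s<s⁻¹ (subst₂ Fin._<_ (eq i) (eq j) (incr (suc i) (suc j) (s<s i<j)))) ,
       λ { zero → g₀≡0 ; (suc i) → eq i }

  lower-all : ∀ g → g zero ≢ zero → Increasing g →
              ∃[ h ] Increasing h × (∀ i → g i ≡ suc (h i))
  lower-all g g₀≢0 incr =
    let (h , eq) = lower g λ { zero → g₀≢0 ; (suc i) → <⇒≢zero (incr zero (suc i) z<s) }
    in h , (λ i j i<j → s<s⁻¹ (subst₂ Fin._<_ (eq i) (eq j) (incr i j i<j))) , eq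

sum-map-const : ∀ {A : Set} c (xs : List A) → sum (map (λ _ → c) xs) ≡ length xs * c
sum-map-const c []       = refl
sum-map-const c (x ∷ xs) = cong (c +_) (sum-map-const c xs)

-- The lower and upper parts of `Fin (m + n)`

↑-elim : ∀ {P : Fin (m + n) → Set} → (∀ i → P (i ↑ˡ n)) → (∀ i → P (m ↑ʳ i)) → ∀ i → P i
↑-elim {m} {n} {P} left right i with splitAt m i | join-splitAt m n i
... | inj₁ x | eq = subst P eq (left x)
... | inj₂ y | eq = subst P eq (right y)

↑ˡ<↑ˡ : ∀ {i j : Fin m} → i Fin.< j → i ↑ˡ n Fin.< j ↑ˡ n
↑ˡ<↑ˡ {n = n} {i} {j} = subst₂ _<_ (sym (toℕ-↑ˡ i n)) (sym (toℕ-↑ˡ j n))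

↑ˡ<↑ˡ⁻¹ : ∀ {i j : Fin m} → i ↑ˡ n Fin.< j ↑ˡ n → i Fin.< j
↑ˡ<↑ˡ⁻¹ {n = n} {i} {j} = subst₂ _<_ (toℕ-↑ˡ i n) (toℕ-↑ˡ j n)

↑ʳ<↑ʳ : ∀ {i j : Fin n} → i Fin.< j → m ↑ʳ i Fin.< m ↑ʳ j
↑ʳ<↑ʳ {m = m} {i} {j} i<j =
  subst₂ _<_ (sym (toℕ-↑ʳ m i)) (sym (toℕ-↑ʳ m j)) (ℕ.+-monoʳ-< m i<j)

↑ʳ<↑ʳ⁻¹ : ∀ {i j : Fin n} → m ↑ʳ i Fin.< m ↑ʳ j → i Fin.< j
↑ʳ<↑ʳ⁻¹ {m = m} {i} {j} i<j =
  ℕ.+-cancelˡ-< m _ _ (subst₂ _<_ (toℕ-↑ʳ m i) (toℕ-↑ʳ m j) i<j)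

toℕ-↑ˡ-< : ∀ (i : Fin m) n → toℕ (i ↑ˡ n) < m
toℕ-↑ˡ-< i n = subst (_< _) (sym (toℕ-↑ˡ i n)) (toℕ<n i)

toℕ-↑ʳ-≥ : ∀ m (i : Fin n) → m ≤ toℕ (m ↑ʳ i)
toℕ-↑ʳ-≥ m i = subst (m ≤_) (sym (toℕ-↑ʳ m i)) (ℕ.m≤m+n m _)

↑ˡ<↑ʳ : ∀ (i : Fin m) (j : Fin n) → i ↑ˡ n Fin.< m ↑ʳ j
↑ˡ<↑ʳ {m} {n} i j = ℕ.<-≤-trans (toℕ-↑ˡ-< i n) (toℕ-↑ʳ-≥ m j)

<⇒↑ˡ : ∀ (x : Fin (m + n)) → toℕ x < m → ∃[ i ] x ≡ i ↑ˡ n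
<⇒↑ˡ {m} {n} = ↑-elim (λ i _ → i , refl)
  λ i i<m → contradiction i<m (ℕ.≤⇒≯ (toℕ-↑ʳ-≥ m i))

≥⇒↑ʳ : ∀ (x : Fin (m + n)) → m ≤ toℕ x → ∃[ i ] x ≡ m ↑ʳ i
≥⇒↑ʳ {m} {n} = ↑-elim
  (λ i m≤i → contradiction m≤i (ℕ.<⇒≱ (toℕ-↑ˡ-< i n)))
  λ i _ → i , refl

-- Rigidity and cuts of increasing sequences

increasing⇒≤ : ∀ (g : Fin l → Fin m) → Increasing g → ∀ i → toℕ i ≤ toℕ (g i)
increasing⇒≤             g incr zero    = z≤n
increasing⇒≤ {m = zero}  g incr (suc i) with () ← g zero
increasing⇒≤ {m = suc m} g incr (suc i) =
  let (h , eq) = lower (g ∘ suc) (λ i → <⇒≢zero (incr zero (suc i) z<s))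
  in subst (λ x → suc (toℕ i) ≤ toℕ x) (sym (eq i))
       (s≤s (increasing⇒≤ h
         (λ a b a<b → s<s⁻¹ (subst₂ Fin._<_ (eq a) (eq b) (incr (suc a) (suc b) (s<s a<b)))) i))

-- Both patterns order positions as `w` does, so a ↦ ρ(σ a) is increasing and a ≤ ρ(σ a) throughout.
-- At a = σ i this reads σ i ≤ ρ i, and exchanging the roles gives the converse.
pattern-unique : ∀ {w : Fin j → Fin k} {σ ρ : Permutation′ j} →
                 IsPatternOf σ w → IsInvolution σ → IsPatternOf ρ w → IsInvolution ρ → σ ≈ ρ
pattern-unique {w = w} {σ} {ρ} σ-pat σ-inv ρ-pat ρ-inv i =
  Fin.≤-antisym (below {σ} {ρ} σ-pat σ-inv ρ-pat i) (below {ρ} {σ} ρ-pat ρ-inv σ-pat i)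
  where
  below : ∀ {σ ρ} → IsPatternOf σ w → IsInvolution σ → IsPatternOf ρ w →
          ∀ i → σ ⟨$⟩ʳ i Fin.≤ ρ ⟨$⟩ʳ i
  below {σ} {ρ} σ-pat σ-inv ρ-pat i =
    subst (λ x → σ ⟨$⟩ʳ i Fin.≤ ρ ⟨$⟩ʳ x) (σ-inv i)
      (increasing⇒≤ (λ a → ρ ⟨$⟩ʳ (σ ⟨$⟩ʳ a))
        (λ a b a<b → Equivalence.to (ρ-pat _ _) (Equivalence.from (σ-pat _ _)
          (subst₂ Fin._<_ (sym (σ-inv a)) (sym (σ-inv b)) a<b)))
        (σ ⟨$⟩ʳ i))

-- Once a value reaches `c`, all later ones do, so the values below `c` form an initial segment.
-- With `c` = `k` and the positions of the letters of `τ` as values, its length is the level `j`.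
threshold : ∀ c (w : Fin k → ℕ) → (∀ r s → r Fin.< s → w r < w s) →
            ∃[ j ] j ≤ k × (∀ r → (toℕ r < j → w r < c) × (j ≤ toℕ r → c ≤ w r))
threshold {zero}  c w incr = 0 , z≤n , λ ()
threshold {suc k} c w incr with w zero ℕ.<? c
... | no w₀≮c = 0 , z≤n , λ where
  zero    → (λ ()) , λ _ → ℕ.≮⇒≥ w₀≮c
  (suc r) → (λ ()) , λ _ → ℕ.≤-trans (ℕ.≮⇒≥ w₀≮c) (ℕ.<⇒≤ (incr zero (suc r) z<s))
... | yes w₀<c =
  let (j , j≤k , cut) = threshold c (w ∘ suc) (λ r s r<s → incr (suc r) (suc s) (s<s r<s))
  in suc j , s≤s j≤k , λ where
    zero    → (λ _ → w₀<c) , λ ()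
    (suc r) → (λ { (s≤s r<j) → proj₁ (cut r) r<j }) , λ { (s≤s j≤r) → proj₂ (cut r) j≤r }

increasing⇒injective : ∀ {g : Fin l → Fin m} → Increasing g → Injective _≡_ _≡_ g
increasing⇒injective incr {x} {y} eq with Fin.<-cmp x y
... | tri< x<y _ _ = contradiction (incr x y x<y) (ℕ.<-irrefl (cong toℕ eq))
... | tri≈ _ x≡y _ = x≡y
... | tri> _ _ y<x = contradiction (incr y x y<x) (ℕ.<-irrefl (cong toℕ (sym eq)))

-- Involutions containing τ

module _ (m : ℕ) (τ : Permutation′ k) where

  letter : Fin k → Fin (k + m)
  letter r = (τ ⟨$⟩ʳ r) ↑ˡ m

  letter-injective : Injective _≡_ _≡_ letter
  letter-injective eq = permutation-injective τ (↑ˡ-injective m _ _ eq)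

  letter-surjective : ∀ x → toℕ x < k → ∃[ r ] x ≡ letter r
  letter-surjective x x<k =
    let (i , x≡i) = <⇒↑ˡ x x<k
    in τ ⟨$⟩ˡ i , trans x≡i (cong (_↑ˡ m) (sym (inverseʳ τ)))

  letter-elim : ∀ {P : Fin (k + m) → Set} → (∀ r → P (letter r)) → (∀ y → P (k ↑ʳ y)) → ∀ x → P x
  letter-elim {P} small large =
    ↑-elim (λ i → subst (λ x → P (x ↑ˡ m)) (inverseʳ τ) (small (τ ⟨$⟩ˡ i))) large

  -- Containment without the occurrence `ι`: applying the involution `π` to π(ι r) = `letter r`
  -- forces ι r = π(`letter r`).
  Good : Permutation′ (k + m) → Set
  Good π = IsInvolution π × Increasing (λ r → π ⟨$⟩ʳ letter r)

  contains⇒good : ∀ {π} → IsInvolution π × Contains π τ → Good π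
  contains⇒good {π} (invo , ι , mono , eq) = invo ,
    λ r s r<s → subst₂ Fin._<_ (position r) (position s) (mono r<s)
    where
    position : ∀ r → ι r ≡ π ⟨$⟩ʳ letter r
    position r = trans (sym (invo (ι r)))
      (cong (π ⟨$⟩ʳ_) (toℕ-injective (trans (eq r) (sym (toℕ-↑ˡ _ m)))))

  good⇒contains : ∀ {π} → Good π → IsInvolution π × Contains π τ
  good⇒contains {π} (invo , incr) = invo , (λ r → π ⟨$⟩ʳ letter r) , (λ {r} {s} → incr r s) ,
    λ r → trans (cong toℕ (invo (letter r))) (toℕ-↑ˡ _ m)

  CutAt : ℕ → Permutation′ (k + m) → Set
  CutAt j π = ∀ r → (toℕ r < j → toℕ (π ⟨$⟩ʳ letter r) < k) ×
                    (j ≤ toℕ r → k ≤ toℕ (π ⟨$⟩ʳ letter r))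

  -- Above `k` every `j` gives the same cut condition as `k` itself, so the bound is what makes the
  -- level unique.
  GoodAt : ℕ → Permutation′ (k + m) → Set
  GoodAt j π = j ≤ k × Good π × CutAt j π

  -- The letter at position `i` separates the cuts: `ρ` sends it below `k`, while `π` sends it to
  -- `k` or above.
  cutAt-≮ : ∀ {i j π ρ} → CutAt i π → CutAt j ρ → π ≈ ρ → j ≤ k → ¬ i < j
  cutAt-≮ {i} {j} {π} {ρ} π-cut ρ-cut π≈ρ j≤k i<j = ℕ.<⇒≱
    (subst (λ x → toℕ x < k) (sym (π≈ρ _)) (proj₁ (ρ-cut s) (subst (_< j) (sym s≡i) i<j)))
    (proj₂ (π-cut s) (ℕ.≤-reflexive (sym s≡i)))
    where
    i<k = ℕ.<-≤-trans i<j j≤k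
    s   = fromℕ< i<k
    s≡i = toℕ-fromℕ< i<k

  goodAt-unique : ∀ {i j π ρ} → GoodAt i π → GoodAt j ρ → π ≈ ρ → i ≡ j
  goodAt-unique {i} {j} {π} {ρ} (i≤k , _ , π-cut) (j≤k , _ , ρ-cut) π≈ρ with ℕ.<-cmp i j
  ... | tri< i<j _ _ = contradiction i<j (cutAt-≮ {π = π} {ρ} π-cut ρ-cut π≈ρ j≤k)
  ... | tri≈ _ i≡j _ = i≡j
  ... | tri> _ _ j<i = contradiction j<i (cutAt-≮ {π = ρ} {π} ρ-cut π-cut (λ x → sym (π≈ρ x)) i≤k)

-- Involutions at a given level `j`, where k = j + l

module _ (m : ℕ) (τ : Permutation′ (j + l)) where
  private
    τ↑ : Fin (j + l) → Fin (j + l + m)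
    τ↑ = letter m τ

    initial : Fin j → Fin (j + l)
    initial = initialWord τ (ℕ.m≤m+n j l)

    initial≡ : ∀ a → initial a ≡ τ ⟨$⟩ʳ (a ↑ˡ l)
    initial≡ a = cong (τ ⟨$⟩ʳ_) (toℕ-injective (trans (toℕ-inject≤ a _) (sym (toℕ-↑ˡ a l))))

  -- `π` permutes the first `j` letters, and read on their positions it becomes an involution `f`.
  -- It is the pattern because `π` is increasing along `τ` and sends the letter at `f a` to the
  -- letter at `a`.
  initialPattern : ∀ π → GoodAt m τ j π → ∃[ σ ] IsPatternOf σ initial × IsInvolution σ ×
                   (∀ a → π ⟨$⟩ʳ τ↑ (a ↑ˡ l) ≡ τ↑ ((σ ⟨$⟩ʳ a) ↑ˡ l))
  initialPattern π (_ , (invo , incr) , cut) = permutation f f f-inv f-inv , pat , f-inv , eq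
    where
    image-initial : ∀ a → ∃[ b ] π ⟨$⟩ʳ τ↑ (a ↑ˡ l) ≡ τ↑ (b ↑ˡ l)
    image-initial a with letter-surjective m τ _ (proj₁ (cut (a ↑ˡ l)) (toℕ-↑ˡ-< a l))
    -- A position `s` from `j` on would have its letter sent to `k` or above, but `π` sends that
    -- letter back to the one at `a`.
    ... | s , πa≡s with <⇒↑ˡ s (ℕ.≰⇒> λ j≤s → ℕ.<⇒≱
            (subst (λ x → toℕ x < j + l) (trans (sym (invo _)) (cong (π ⟨$⟩ʳ_) πa≡s)) (toℕ-↑ˡ-< _ m))
            (proj₂ (cut s) j≤s))
    ... | b , refl = b , πa≡s

    f : Fin j → Fin j
    f a = proj₁ (image-initial a)

    eq : ∀ a → π ⟨$⟩ʳ τ↑ (a ↑ˡ l) ≡ τ↑ (f a ↑ˡ l)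
    eq a = proj₂ (image-initial a)

    f-inv : ∀ a → f (f a) ≡ a
    f-inv a = ↑ˡ-injective l _ _ (letter-injective m τ
      (trans (sym (eq (f a))) (trans (cong (π ⟨$⟩ʳ_) (sym (eq a))) (invo _))))

    increasing : ∀ a b → f a Fin.< f b → τ ⟨$⟩ʳ (a ↑ˡ l) Fin.< τ ⟨$⟩ʳ (b ↑ˡ l)
    increasing a b fa<fb = ↑ˡ<↑ˡ⁻¹ (subst₂ Fin._<_ (back a) (back b)
      (incr (f a ↑ˡ l) (f b ↑ˡ l) (↑ˡ<↑ˡ fa<fb)))
      where
      back : ∀ a → π ⟨$⟩ʳ τ↑ (f a ↑ˡ l) ≡ τ↑ (a ↑ˡ l)
      back a = trans (eq (f a)) (cong (λ x → τ↑ (x ↑ˡ l)) (f-inv a))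

    reflecting : ∀ a b → τ ⟨$⟩ʳ (a ↑ˡ l) Fin.< τ ⟨$⟩ʳ (b ↑ˡ l) → f a Fin.< f b
    reflecting a b τa<τb with Fin.<-cmp (f a) (f b)
    ... | tri< fa<fb _ _ = fa<fb
    ... | tri> _ _ fb<fa = contradiction (increasing b a fb<fa) (ℕ.<-asym τa<τb)
    ... | tri≈ _ fa≡fb _ = contradiction τa<τb
      (ℕ.<-irrefl (cong (λ x → toℕ (τ ⟨$⟩ʳ (x ↑ˡ l)))
        (trans (sym (f-inv a)) (trans (cong f fa≡fb) (f-inv b)))))

    pat : IsPatternOf (permutation f f f-inv f-inv) initial
    pat a b = mk⇔
      (reflecting a b ∘ subst₂ Fin._<_ (initial≡ a) (initial≡ b))
      (subst₂ Fin._<_ (sym (initial≡ a)) (sym (initial≡ b)) ∘ increasing a b)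

  module _ (σ : Permutation′ j) (σ-pat : IsPatternOf σ initial) (σ-inv : IsInvolution σ) where

    -- Only the images of the letters are prescribed; being an involution, `π` then has forced
    -- values at the points `g i` above `k`.
    Extends : (Fin l → Fin m) → Permutation′ (j + l + m) → Set
    Extends g π = IsInvolution π ×
      (∀ a → π ⟨$⟩ʳ τ↑ (a ↑ˡ l) ≡ τ↑ ((σ ⟨$⟩ʳ a) ↑ˡ l)) ×
      (∀ i → π ⟨$⟩ʳ τ↑ (j ↑ʳ i) ≡ (j + l) ↑ʳ g i)

    extends-resp : ∀ {g h π} → (∀ i → g i ≡ h i) → Extends g π → Extends h π
    extends-resp g≈h (invo , small , large) =
      invo , small , λ i → trans (large i) (cong ((j + l) ↑ʳ_) (g≈h i))

    extends-unique : ∀ {g h π ρ} → Extends g π → Extends h ρ → π ≈ ρ → ∀ i → g i ≡ h i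
    extends-unique (_ , _ , π-large) (_ , _ , ρ-large) π≈ρ i = ↑ʳ-injective (j + l) _ _
      (trans (sym (π-large i)) (trans (π≈ρ _) (ρ-large i)))

    goodAt⇒extends : ∀ {π} → GoodAt m τ j π → ∃[ g ] Increasing g × Extends g π
    goodAt⇒extends {π} good@(_ , (invo , incr) , cut) = proj₁ ∘ above ,
      (λ i i′ i<i′ → ↑ʳ<↑ʳ⁻¹ (subst₂ Fin._<_ (proj₂ (above i)) (proj₂ (above i′))
        (incr (j ↑ʳ i) (j ↑ʳ i′) (↑ʳ<↑ʳ i<i′)))) ,
      invo , small , proj₂ ∘ above
      where
      above : ∀ i → ∃[ y ] π ⟨$⟩ʳ τ↑ (j ↑ʳ i) ≡ (j + l) ↑ʳ y
      above i = ≥⇒↑ʳ _ (proj₂ (cut (j ↑ʳ i)) (toℕ-↑ʳ-≥ j i))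

      small : ∀ a → π ⟨$⟩ʳ τ↑ (a ↑ˡ l) ≡ τ↑ ((σ ⟨$⟩ʳ a) ↑ˡ l)
      small a =
        -- The pattern read off from `π` must be the given `σ`, since both are involutive patterns
        -- of the same word.
        let (ρ , ρ-pat , ρ-inv , eq) = initialPattern π good
        in trans (eq a) (cong (λ x → τ↑ (x ↑ˡ l))
             (pattern-unique {σ = ρ} {σ} ρ-pat ρ-inv σ-pat σ-inv a))

    extends⇒goodAt : ∀ {g π} → Increasing g → Extends g π → GoodAt m τ j π
    extends⇒goodAt {g} {π} g-incr (invo , small , large) = ℕ.m≤m+n j l , (invo , incr) , ↑-elim
      (λ a → (λ _ → subst (λ x → toℕ x < j + l) (sym (small a)) (toℕ-↑ˡ-< _ m)) ,
             λ j≤a → contradiction j≤a (ℕ.<⇒≱ (toℕ-↑ˡ-< a l)))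
      (λ i → (λ i<j → contradiction i<j (ℕ.≤⇒≯ (toℕ-↑ʳ-≥ j i))) ,
             λ _ → subst (λ x → j + l ≤ toℕ x) (sym (large i)) (toℕ-↑ʳ-≥ (j + l) (g i)))
      where
      -- Writing `a` and `b` as σ(σ a) and σ(σ b) lets the pattern condition compare the letters at
      -- σ a and σ b.
      small-incr : ∀ a b → a Fin.< b → τ↑ ((σ ⟨$⟩ʳ a) ↑ˡ l) Fin.< τ↑ ((σ ⟨$⟩ʳ b) ↑ˡ l)
      small-incr a b a<b = ↑ˡ<↑ˡ (subst₂ Fin._<_ (initial≡ _) (initial≡ _)
        (Equivalence.from (σ-pat _ _) (subst₂ Fin._<_ (sym (σ-inv a)) (sym (σ-inv b)) a<b)))

      incr : Increasing (λ r → π ⟨$⟩ʳ τ↑ r)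
      incr = ↑-elim
        (λ a → ↑-elim
          (λ b a<b → subst₂ Fin._<_ (sym (small a)) (sym (small b)) (small-incr a b (↑ˡ<↑ˡ⁻¹ a<b)))
          (λ i _ → subst₂ Fin._<_ (sym (small a)) (sym (large i)) (↑ˡ<↑ʳ _ (g i))))
        (λ i → ↑-elim
          (λ b i<b → contradiction i<b (ℕ.<-asym (↑ˡ<↑ʳ b i)))
          (λ i′ i<i′ → subst₂ Fin._<_ (sym (large i)) (sym (large i′))
            (↑ʳ<↑ʳ (g-incr i i′ (↑ʳ<↑ʳ⁻¹ i<i′)))))

    -- The involution π₀ below is the extension that fixes every point outside the range of d.
    module _ (g : Fin l → Fin m) (g-inj : Injective _≡_ _≡_ g) where
      private
        small : Fin (j + l) → Fin (j + l + m)
        small r = [ (λ a → τ↑ ((σ ⟨$⟩ʳ a) ↑ˡ l)) , (λ i → (j + l) ↑ʳ g i) ]′ (splitAt j r)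

        large : Fin m → Fin (j + l + m)
        large y with any? (λ i → g i Fin.≟ y)
        ... | yes (i , _) = τ↑ (j ↑ʳ i)
        ... | no  _       = (j + l) ↑ʳ y

        f : Fin (j + l + m) → Fin (j + l + m)
        f x = [ (λ i → small (τ ⟨$⟩ˡ i)) , large ]′ (splitAt (j + l) x)

        f-letter : ∀ r → f (τ↑ r) ≡ small r
        f-letter r rewrite splitAt-↑ˡ (j + l) (τ ⟨$⟩ʳ r) m = cong small (inverseˡ τ)

        f-initial : ∀ a → f (τ↑ (a ↑ˡ l)) ≡ τ↑ ((σ ⟨$⟩ʳ a) ↑ˡ l)
        f-initial a = trans (f-letter (a ↑ˡ l)) (cong [ _ , _ ]′ (splitAt-↑ˡ j a l))

        f-final : ∀ i → f (τ↑ (j ↑ʳ i)) ≡ (j + l) ↑ʳ g i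
        f-final i = trans (f-letter (j ↑ʳ i)) (cong [ _ , _ ]′ (splitAt-↑ʳ j l i))

        f-large : ∀ y → f ((j + l) ↑ʳ y) ≡ large y
        f-large y = cong [ _ , _ ]′ (splitAt-↑ʳ (j + l) m y)

        f-image : ∀ i → f ((j + l) ↑ʳ g i) ≡ τ↑ (j ↑ʳ i)
        f-image i = trans (f-large (g i)) large-image
          where
          large-image : large (g i) ≡ τ↑ (j ↑ʳ i)
          large-image with any? (λ i′ → g i′ Fin.≟ g i)
          -- The search may return another index with the same value; injectivity of `g` identifies
          -- it with `i`.
          ... | yes (i′ , eq) = cong (λ x → τ↑ (j ↑ʳ x)) (g-inj eq)
          ... | no  ∄i        = contradiction (i , refl) ∄i

        f-other : ∀ y → ¬ (∃[ i ] g i ≡ y) → f ((j + l) ↑ʳ y) ≡ (j + l) ↑ʳ y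
        f-other y ∄i = trans (f-large y) large-other
          where
          large-other : large y ≡ (j + l) ↑ʳ y
          large-other with any? (λ i → g i Fin.≟ y)
          ... | yes ∃i = contradiction ∃i ∄i
          ... | no  _  = refl

        f-inv : ∀ x → f (f x) ≡ x
        f-inv = letter-elim m τ
          (↑-elim
            (λ a → trans (cong f (f-initial a)) (trans (f-initial _) (cong (λ x → τ↑ (x ↑ˡ l)) (σ-inv a))))
            (λ i → trans (cong f (f-final i)) (f-image i)))
          f-inv-large
          where
          f-inv-large : ∀ y → f (f ((j + l) ↑ʳ y)) ≡ (j + l) ↑ʳ y
          f-inv-large y with any? (λ i → g i Fin.≟ y)
          ... | yes (i , refl) = trans (cong f (f-image i)) (f-final i)
          ... | no  ∄i         = trans (cong f (f-other y ∄i)) (f-other y ∄i)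

        π₀ : Permutation′ (j + l + m)
        π₀ = permutation f f f-inv f-inv

        -- The closed set of j + 2l = 2k - j points: the `k` letters, followed by the positions that
        -- `g` selects above `k`.
        d : Fin (j + l + l) → Fin (j + l + m)
        d i = [ τ↑ , (λ i → (j + l) ↑ʳ g i) ]′ (splitAt (j + l) i)

        d-↑ˡ : ∀ r → d (r ↑ˡ l) ≡ τ↑ r
        d-↑ˡ r = cong [ _ , _ ]′ (splitAt-↑ˡ (j + l) r l)

        d-↑ʳ : ∀ i → d ((j + l) ↑ʳ i) ≡ (j + l) ↑ʳ g i
        d-↑ʳ i = cong [ _ , _ ]′ (splitAt-↑ʳ (j + l) l i)

        d-inj : Injective _≡_ _≡_ d
        d-inj {x} {y} = ↑-elim {P = λ x → ∀ y → d x ≡ d y → x ≡ y}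
          (λ r → ↑-elim
            (λ s eq → cong (_↑ˡ l) (letter-injective m τ (trans (sym (d-↑ˡ r)) (trans eq (d-↑ˡ s)))))
            (λ i eq → contradiction (↑ˡ<↑ʳ _ (g i))
              (ℕ.<-irrefl (cong toℕ (trans (sym (d-↑ˡ r)) (trans eq (d-↑ʳ i)))))))
          (λ i → ↑-elim
            (λ s eq → contradiction (↑ˡ<↑ʳ _ (g i))
              (ℕ.<-irrefl (cong toℕ (trans (sym (d-↑ˡ s)) (trans (sym eq) (d-↑ʳ i))))))
            (λ i′ eq → cong ((j + l) ↑ʳ_) (g-inj (↑ʳ-injective (j + l) _ _
              (trans (sym (d-↑ʳ i)) (trans eq (d-↑ʳ i′)))))))
          x y

        closed : ∀ i → ∃[ i′ ] f (d i) ≡ d i′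
        closed = ↑-elim
          (↑-elim
            -- The closing equations determine the witnesses: `σ` permutes the initial letters, and
            -- each remaining letter is swapped with its `g i`.
            (λ a → _ , trans (cong f (d-↑ˡ _)) (trans (f-initial a) (sym (d-↑ˡ _))))
            (λ i → _ , trans (cong f (d-↑ˡ _)) (trans (f-final i) (sym (d-↑ʳ i)))))
          (λ i → _ , trans (cong f (d-↑ʳ i)) (trans (f-image i) (sym (d-↑ˡ _))))

        support : ∀ x → (∃[ i ] x ≡ d i) ⊎ f x ≡ x
        support = letter-elim m τ (λ r → inj₁ (r ↑ˡ l , sym (d-↑ˡ r))) support-large
          where
          support-large : ∀ y → (∃[ i ] (j + l) ↑ʳ y ≡ d i) ⊎ f ((j + l) ↑ʳ y) ≡ (j + l) ↑ʳ y
          support-large y with any? (λ i → g i Fin.≟ y)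
          ... | yes (i , refl) = inj₁ ((j + l) ↑ʳ i , sym (d-↑ʳ i))
          ... | no  ∄i         = inj₂ (f-other y ∄i)

        agree⇒extends : ∀ {π} → IsInvolution π × (∀ i → π ⟨$⟩ʳ d i ≡ f (d i)) → Extends g π
        agree⇒extends {π} (invo , agree) =
          invo , (λ a → trans (agree′ _) (f-initial a)) , λ i → trans (agree′ _) (f-final i)
          where
          agree′ : ∀ r → π ⟨$⟩ʳ τ↑ r ≡ f (τ↑ r)
          agree′ r = subst (λ x → π ⟨$⟩ʳ x ≡ f x) (d-↑ˡ r) (agree (r ↑ˡ l))

        extends⇒agree : ∀ {π} → Extends g π → IsInvolution π × (∀ i → π ⟨$⟩ʳ d i ≡ f (d i))
        extends⇒agree {π} (invo , initials , finals) = invo , ↑-elim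
          (λ r → subst (λ x → π ⟨$⟩ʳ x ≡ f x) (sym (d-↑ˡ r)) (↑-elim {P = λ r → π ⟨$⟩ʳ τ↑ r ≡ f (τ↑ r)}
            (λ a → trans (initials a) (sym (f-initial a)))
            (λ i → trans (finals i) (sym (f-final i))) r))
          -- The point `g i` is the image of a letter, so involutivity returns it to that letter.
          (λ i → subst (λ x → π ⟨$⟩ʳ x ≡ f x) (sym (d-↑ʳ i))
            (trans (cong (π ⟨$⟩ʳ_) (sym (finals i))) (trans (invo _) (sym (f-image i)))))

      enumerate-extends : Enumeration (≈-setoid (j + l + m)) (Extends g) (t ((j + l + m) ∸ (j + l + l)))
      enumerate-extends = mapPred
        (λ {π} → agree⇒extends {π}) (λ {π} → extends⇒agree {π})
        (enumerate-extensions d d-inj π₀ f-inv closed support)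

    -- There is one block for each increasing `g`, all of the same size, and they are disjoint
    -- because `π` determines `g`. An increasing `g` amounts to an `l`-subset of the `m` positions
    -- above `k`.
    enumerate-goodAt : Enumeration (≈-setoid (j + l + m)) (GoodAt m τ j)
                         ((m C l) * t ((j + l + m) ∸ (j + l + l)))
    enumerate-goodAt = subst (Enumeration _ _)
      (trans (sum-map-const c elements) (cong (_* c) size))
      (mapPred
        (λ {π} → any⇒goodAt {π}) (λ {π} → goodAt⇒any {π})
        (⋃ {T = pointwise l m} {Q = Extends} unique
          (λ {g} {h} {π} {ρ} → extends-unique {g} {h} {π} {ρ})
          (All.map (λ {g} incr → enumerate-extends g (increasing⇒injective incr)) sound)))
      where
      open Enumeration (enumerate-increasing l m)

      c = t ((j + l + m) ∸ (j + l + l))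

      any⇒goodAt : ∀ {π} → Any (λ g → Extends g π) elements → GoodAt m τ j π
      any⇒goodAt {π} any =
        let (incr , ext) = All.lookupAny sound any in extends⇒goodAt {π = π} incr ext

      goodAt⇒any : ∀ {π} → GoodAt m τ j π → Any (λ g → Extends g π) elements
      goodAt⇒any {π} good =
        let (g , incr , ext) = goodAt⇒extends {π} good
        -- The list holds `g` only up to pointwise equality, so `Extends` is carried over to the
        -- listed function.
        in Any.map (λ g≈h → extends-resp {π = π} g≈h ext) (complete incr)

-- Summation over the levels in the j-set

term : ℕ → ℕ → ℕ → ℕ
term n k j = ((n ∸ k) C (k ∸ j)) * t ((n + j) ∸ 2 * k)

-- Both arguments of `t` equal `m ∸ l`. For l > m truncation makes this 0, and the binomial
-- coefficient kills the term.
term-+ : ∀ j l m → (m C l) * t ((j + l + m) ∸ (j + l + l)) ≡ term (j + l + m) (j + l) j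
term-+ j l m = cong₂ _*_
  (cong₂ _C_ (sym (ℕ.m+n∸m≡n (j + l) m)) (sym (ℕ.m+n∸m≡n j l)))
  (cong t (begin
    (j + l + m) ∸ (j + l + l)               ≡⟨ ℕ.[m+n]∸[m+o]≡n∸o (j + l) m l ⟩
    m ∸ l                                   ≡⟨ ℕ.[m+n]∸[m+o]≡n∸o j m l ⟨
    -- The `0` comes from `2 * k`, which unfolds to `k + (k + 0)`.
    (j + m) ∸ (j + l)                       ≡⟨ cong₂ _∸_ (ℕ.+-comm j m) (sym (ℕ.+-identityʳ (j + l))) ⟩
    (m + j) ∸ (j + l + 0)                   ≡⟨ ℕ.[m+n]∸[m+o]≡n∸o (j + l) (m + j) (j + l + 0) ⟨
    (j + l + (m + j)) ∸ 2 * (j + l)         ≡⟨ cong (_∸ 2 * (j + l)) (ℕ.+-assoc (j + l) m j) ⟨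
    (j + l + m + j) ∸ 2 * (j + l)           ∎))
  where open ≡-Reasoning

module _ (m : ℕ) where

  enumerate-level : ∀ (τ : Permutation′ k) (j≤k : j ≤ k) → InitialPatternIsInvolution τ j≤k →
                    Enumeration (≈-setoid (k + m)) (GoodAt m τ j) (term (k + m) k j)
  enumerate-level {j = j} τ j≤k (σ , σ-pat , σ-inv) with (l , refl) ← ℕ.m≤n⇒∃[o]m+o≡n j≤k =
    subst (Enumeration _ _) (term-+ j l m) (enumerate-goodAt m τ σ σ-pat σ-inv)

  -- Level 0 belongs to the j-set by decree; the empty permutation, an involution, lets it be
  -- treated like the others.
  inJSet⇒pattern : ∀ (τ : Permutation′ k) → InJSet τ j →
                   ∃[ j≤k ] InitialPatternIsInvolution {j = j} τ j≤k
  inJSet⇒pattern τ (inj₁ refl)    = z≤n , id , (λ ()) , λ ()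
  inJSet⇒pattern τ (inj₂ (_ , p)) = p

  -- Levels outside the j-set are empty, so the sum over `jSet τ` misses no involution.
  goodAt⇒inJSet : ∀ (τ : Permutation′ k) π → GoodAt m τ j π → InJSet τ j
  goodAt⇒inJSet {j = zero}  τ π good = inj₁ refl
  goodAt⇒inJSet {j = suc j} τ π good@(j≤k , _) with (l , refl) ← ℕ.m≤n⇒∃[o]m+o≡n j≤k =
    let (σ , σ-pat , σ-inv , _) = initialPattern m τ π good
    in inj₂ (s≤s z≤n , ℕ.m≤m+n (suc j) l , σ , σ-pat , σ-inv)

  good⇒any : ∀ (τ : Permutation′ k) π → Good m τ π → Any (λ j → GoodAt m τ j π) (jSet τ)
  good⇒any {k} τ π good@(_ , incr) =
    let (j , j≤k , cut) = threshold k (λ r → toℕ (π ⟨$⟩ʳ letter m τ r)) incr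
        goodAt          = j≤k , good , cut
    in Any.map (λ { refl → goodAt })
         (Membership.∈-filter⁺ (inJSet? τ) (Membership.∈-upTo⁺ (s≤s j≤k))
           (goodAt⇒inJSet τ π goodAt))

  any⇒good : ∀ (τ : Permutation′ k) π → Any (λ j → GoodAt m τ j π) (jSet τ) → Good m τ π
  any⇒good τ π any = let (_ , _ , good , _) = Any.satisfied any in good

  -- Double counting: the filter in `inv` and the disjoint union of the levels enumerate the same
  -- involutions.
  inv-+ : ∀ (τ : Permutation′ k) → inv (k + m) τ ≡ sum (map (term (k + m) k) (jSet τ))
  inv-+ {k} τ = size-unique
    (enumerate-permutations (λ π → isInvolution? π ×-dec contains? π τ) λ {π} {ρ} → resp {π} {ρ})
    (mapPred (λ {π} → good⇒contains m τ {π} ∘ any⇒good τ π)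
             (λ {π} → good⇒any τ π ∘ contains⇒good m τ {π})
      (⋃ {T = setoid ℕ} {Q = GoodAt m τ} (Unique.filter⁺ (inJSet? τ) (Unique.upTo⁺ (suc k)))
        (λ {i} {j} {π} {ρ} → goodAt-unique m τ {i} {j} {π} {ρ})
        (All.tabulate λ j∈ →
          let (j≤k , p) = inJSet⇒pattern τ (proj₂
                (Membership.∈-filter⁻ (inJSet? τ) {xs = upTo (suc k)} j∈))
          in enumerate-level τ j≤k p)))
    where
    resp : (λ π → IsInvolution π × Contains π τ) Respects _≈_
    resp {π} {ρ} π≈ρ (invo , ι , mono , eq) =
      isInvolution-resp {x = π} {ρ} π≈ρ invo , ι , mono ,
      λ r → trans (cong toℕ (sym (π≈ρ (ι r)))) (eq r)

mainTheorem3 : ∀ (k : ℕ) (τ : Permutation′ k) (n : ℕ) → k ≤ n →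
    inv n τ ≡ sum (map (λ j → ((n ∸ k) C (k ∸ j)) * t ((n + j) ∸ 2 * k)) (jSet τ))
mainTheorem3 k τ n k≤n with (m , refl) ← ℕ.m≤n⇒∃[o]m+o≡n k≤n = inv-+ m τ
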